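{- Let $\mathcal{R}$ be a set of nontrivial rules on a finite set $Q$, and let $\mathcal{C}=\{(A\cup\{q\},q): (A,q)\in\mathcal{R}\}$. Then $\mathcal{A}(\mathcal{R})=\mathcal{L}(\mathcal{C})$.
   Context: A rule on $Q$ is a pair $(A,q)$ with $A\subseteq Q$, $q\in Q$; it is nontrivial if $q\notin A$. It accepts $X\subseteq Q$ if $q\in X$ implies $X\cap A\neq\emptyset$. $\mathcal{K}(\mathcal{R})$ is the family of subsets of $Q$ accepted by all rules of $\mathcal{R}$, and $\mathcal{A}(\mathcal{R})$ is the family of $K\in\mathcal{K}(\mathcal{R})$ for which there is a sequence $\emptyset=Y_0\subseteq Y_1\subseteq\dots\subseteq Y_k=K$ of members of $\mathcal{K}(\mathcal{R})$ with $|Y_{i+1}\setminus Y_i|=1$ for all $i$. A rooted set is a pair $(C,r)$ with $C\subseteq Q$ and $r\in C$. For a family $\mathcal{C}$ of rooted sets, $\mathcal{L}(\mathcal{C})$ is the family of subsets $X\subseteq Q$ admitting an ordering $x_1,\dots,x_k$ of the elements of $X$ such that for each $i$, whenever $(C,x_i)\in\mathcal{C}$ one has $C\cap\{x_1,\dots,x_{i-1}\}\neq\emptyset$. -}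

module Defs where

open import Level using (Level)
open import Data.Nat.Base using (ℕ; suc)
open import Data.Fin.Base using (Fin; zero; suc; fromℕ; inject₁; _<_)
open import Data.Fin.Subset
  using (Subset; _∈_; _∉_; _⊆_; _∩_; _∪_; _─_; ⁅_⁆; ∣_∣; Nonempty; ⊥)
open import Data.Fin.Subset.Properties using (x∈⁅x⁆; q⊆p∪q)
open import Data.Product.Base using (∃; _×_)
open import Function.Bundles using (_⇔_)
open import Function.Definitions using (Injective)
open import Relation.Binary.PropositionalEquality.Core using (_≡_)
open import Relation.Unary using (Pred; _≬_)

private
  variable
    n : ℕ
    ℓ : Level

-- Throughout, the finite ground set Q is Fin n.  A set of rules, of subsets
-- or of rooted sets is an arbitrary (not necessarily decidable) predicate.

record Rule (n : ℕ) : Set where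
  field
    body : Subset n
    head : Fin n

open Rule public

Nontrivial : Rule n → Set
Nontrivial ρ = head ρ ∉ body ρ

Accepts : Rule n → Subset n → Set
Accepts ρ X = head ρ ∈ X → Nonempty (X ∩ body ρ)

𝒦 : Pred (Rule n) ℓ → Pred (Subset n) ℓ
𝒦 R X = ∀ ρ → R ρ → Accepts ρ X

-- The sequence Y₀ ⊆ … ⊆ Yₖ is a function on Fin (suc k); for i : Fin k,
-- inject₁ i and suc i are the consecutive indices i and i + 1.
record Chain (F : Pred (Subset n) ℓ) (K : Subset n) : Set ℓ where
  field
    k      : ℕ
    Y      : Fin (suc k) → Subset n
    member : ∀ i → F (Y i)
    start  : Y zero ≡ ⊥
    end    : Y (fromℕ k) ≡ K
    mono   : ∀ (i : Fin k) → Y (inject₁ i) ⊆ Y (suc i)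
    step   : ∀ (i : Fin k) → ∣ Y (suc i) ─ Y (inject₁ i) ∣ ≡ 1

𝒜 : Pred (Rule n) ℓ → Pred (Subset n) ℓ
𝒜 R K = 𝒦 R K × Chain (𝒦 R) K

record RootedSet (n : ℕ) : Set where
  field
    carrier      : Subset n
    root         : Fin n
    root∈carrier : root ∈ carrier

open RootedSet public

record Ordering (X : Subset n) : Set where
  field
    k         : ℕ
    x         : Fin k → Fin n
    injective : Injective _≡_ _≡_ x
    image     : ∀ q → q ∈ X ⇔ ∃ λ i → x i ≡ q

  Before : Fin k → Pred (Fin n) _
  Before i q = ∃ λ j → j < i × x j ≡ q

ℒ : Pred (RootedSet n) ℓ → Pred (Subset n) ℓ
ℒ C X = ∃ λ (o : Ordering X) → let open Ordering o in
  ∀ i c → C c → root c ≡ x i → (_∈ carrier c) ≬ Before i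

rooted : Rule n → RootedSet n
rooted ρ = record
  { carrier      = body ρ ∪ ⁅ head ρ ⁆
  ; root         = head ρ
  ; root∈carrier = q⊆p∪q (body ρ) ⁅ head ρ ⁆ (x∈⁅x⁆ (head ρ))
  }

𝒞 : Pred (Rule n) ℓ → Pred (RootedSet n) ℓ
𝒞 R c = ∃ λ ρ → R ρ × rooted ρ ≡ c

{-# OPTIONS --safe #-}
-- A chain ∅ = Y₀ ⊂ … ⊂ Yₖ = K whose steps add one element each is the same thing
-- as an ordering x₁, …, xₖ of K, with Yᵢ = {x₁, …, xᵢ}.  If (A, q) is a
-- nontrivial rule and q = xᵢ, acceptance of Yᵢ gives an element of A in
-- {x₁, …, xᵢ} other than q, that is, one before xᵢ.  Conversely an element of
-- A ∪ {q} before xᵢ = q lies in A and in every Yⱼ that contains q.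
module Submission where

open import Defs
open import Level using (Level)
open import Data.Nat.Base as ℕ using (ℕ; suc)
import Data.Nat.Properties as ℕ
open import Data.Fin.Base using (Fin; zero; suc; toℕ; fromℕ; inject₁; _<_)
open import Data.Fin.Induction using (<-weakInduction)
open import Data.Fin.Properties
  using (_≟_; _<?_; any?; toℕ-inject₁; toℕ-fromℕ; toℕ-injective; toℕ<n; <-cmp; <-irrefl)
open import Data.Fin.Subset
  using (Subset; inside; outside; _∈_; _∉_; _─_; _-_; ⁅_⁆; ∣_∣; ⊥)
open import Data.Fin.Subset.Properties
open import Data.Product.Base using (∃; _×_; _,_; proj₁; proj₂)
open import Data.Sum.Base using (_⊎_; inj₁; inj₂; [_,_]′)
open import Data.Vec.Base using (_∷_; tabulate; here; there)
open import Data.Vec.Properties using (lookup∘tabulate; lookup⇒[]=; []=⇒lookup)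
open import Function.Base using (_∘_)
open import Function.Bundles using (_⇔_; mk⇔; module Equivalence)
open import Function.Definitions using (Injective)
open import Relation.Binary.Definitions using (tri<; tri≈; tri>)
open import Relation.Binary.PropositionalEquality
  using (_≡_; refl; sym; trans; cong; subst)
open import Relation.Nullary.Decidable
  using (yes; no; does; dec-true; _×-dec_)
open import Relation.Nullary.Negation using (¬_; contradiction)
open import Relation.Unary using (Pred; Decidable; _⊆_; _≐_; _≬_)

open Equivalence using (to; from)

private
  variable
    m n : ℕ
    ℓ : Level

x∈p─q⇒x∉q : ∀ {x} (p q : Subset n) → x ∈ p ─ q → x ∉ q
x∈p─q⇒x∉q (inside  ∷ p) (inside ∷ q) ()          here
x∈p─q⇒x∉q (outside ∷ p) (inside ∷ q) ()          here
x∈p─q⇒x∉q (_ ∷ p)       (_ ∷ q)      (there x∈d) (there x∈q) = x∈p─q⇒x∉q p q x∈d x∈q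

∣p∣≡1⇒p≡⁅x⁆ : (p : Subset n) → ∣ p ∣ ≡ 1 → ∃ λ x → p ≡ ⁅ x ⁆
∣p∣≡1⇒p≡⁅x⁆ (outside ∷ p) ∣p∣≡1 with ∣p∣≡1⇒p≡⁅x⁆ p ∣p∣≡1
... | x , p≡⁅x⁆ = suc x , cong (outside ∷_) p≡⁅x⁆
∣p∣≡1⇒p≡⁅x⁆ (inside ∷ p) ∣p∣≡1 =
  -- The tail has size 0, and removing a supposed element from it would give a size below 0.
  zero , cong (inside ∷_) (Empty-unique λ (x , x∈p) →
    ℕ.n≮0 (subst (∣ p - x ∣ ℕ.<_) (ℕ.suc-injective ∣p∣≡1) (x∈p⇒∣p-x∣<∣p∣ x∈p)))

module _ {P : Pred (Fin n) ℓ} (P? : Decidable P) where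

  -- A `Subset` is a Boolean vector, so the decision procedure supplies its entries.
  comprehension : Subset n
  comprehension = tabulate (does ∘ P?)

  ∈-comprehension : ∀ {q} → q ∈ comprehension ⇔ P q
  ∈-comprehension {q} = mk⇔ sound complete
    where
    sound : q ∈ comprehension → P q
    sound q∈ with P? q | trans (sym (lookup∘tabulate (does ∘ P?) q)) ([]=⇒lookup q∈)
    -- The `no` case is absent because the equation would then read `false ≡ true`.
    ... | yes Pq | _ = Pq

    complete : P q → q ∈ comprehension
    complete Pq = lookup⇒[]= q comprehension
      (trans (lookup∘tabulate (does ∘ P?) q) (dec-true (P? q) Pq))

-- The index i may be an element of Fin (suc k), so that fromℕ k gives the whole sequence.
Prefix : ∀ {k} → (Fin k → Fin n) → Fin m → Pred (Fin n) _
Prefix x i q = ∃ λ j → j < i × x j ≡ q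

module _ {k} (x : Fin k → Fin n) where

  prefix? : (i : Fin m) → Decidable (Prefix x i)
  prefix? i q = any? λ j → (j <? i) ×-dec (x j ≟ q)

  prefix-inject₁ : ∀ {i : Fin m} {q} → Prefix x (inject₁ i) q ⇔ Prefix x i q
  prefix-inject₁ {i = i} = mk⇔
    (λ (j , j<i , eq) → j , subst (toℕ j ℕ.<_) (toℕ-inject₁ i) j<i , eq)
    (λ (j , j<i , eq) → j , subst (toℕ j ℕ.<_) (sym (toℕ-inject₁ i)) j<i , eq)

  prefix-suc : ∀ {i q} → Prefix x (suc i) q ⇔ (Prefix x i q ⊎ x i ≡ q)
  prefix-suc {i} {q} = mk⇔ split join
    where
    split : Prefix x (suc i) q → Prefix x i q ⊎ x i ≡ q
    split (j , j<1+i , eq) with ℕ.m<1+n⇒m<n∨m≡n j<1+i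
    ... | inj₁ j<i = inj₁ (j , j<i , eq)
    ... | inj₂ j≡i = inj₂ (subst (λ l → x l ≡ q) (toℕ-injective j≡i) eq)

    join : Prefix x i q ⊎ x i ≡ q → Prefix x (suc i) q
    join (inj₁ (j , j<i , eq)) = j , ℕ.m<n⇒m<1+n j<i , eq
    join (inj₂ eq)             = i , ℕ.n<1+n _ , eq

  prefix-fromℕ : ∀ {q} → Prefix x (fromℕ k) q ⇔ ∃ λ j → x j ≡ q
  prefix-fromℕ = mk⇔
    (λ (j , _ , eq) → j , eq)
    (λ (j , eq) → j , subst (toℕ j ℕ.<_) (sym (toℕ-fromℕ k)) (toℕ<n j) , eq)

  -- If two distinct indices shared a value, the smaller would put it in the prefix of the larger.
  fresh⇒injective : (∀ i → ¬ Prefix x i (x i)) → Injective _≡_ _≡_ x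
  fresh⇒injective fresh {i} {j} eq with <-cmp i j
  ... | tri< i<j _ _ = contradiction (i , i<j , eq) (fresh j)
  ... | tri≈ _ i≡j _ = i≡j
  ... | tri> _ _ j<i = contradiction (j , j<i , sym eq) (fresh i)

  injective⇒fresh : Injective _≡_ _≡_ x → ∀ i → ¬ Prefix x i (x i)
  injective⇒fresh inj i (j , j<i , eq) = <-irrefl (inj eq) j<i

module ChainToOrdering {F : Pred (Subset n) ℓ} {K : Subset n} (chain : Chain F K) where
  open Chain chain

  private
    added : ∀ i → ∃ λ q → Y (suc i) ─ Y (inject₁ i) ≡ ⁅ q ⁆
    added i = ∣p∣≡1⇒p≡⁅x⁆ _ (step i)

  x : Fin k → Fin n
  x i = proj₁ (added i)

  x∈difference : ∀ i → x i ∈ Y (suc i) ─ Y (inject₁ i)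
  x∈difference i = subst (x i ∈_) (sym (proj₂ (added i))) (x∈⁅x⁆ (x i))

  -- The difference of consecutive sets is the singleton of `x i`, and `mono` ensures that nothing
  -- is lost. This is the recursion that `prefix-suc` gives for prefixes.
  ∈Y-suc : ∀ i {q} → q ∈ Y (suc i) ⇔ (q ∈ Y (inject₁ i) ⊎ x i ≡ q)
  ∈Y-suc i {q} = mk⇔ split [ mono i , (λ { refl → p─q⊆p _ _ (x∈difference i) }) ]′
    where
    split : q ∈ Y (suc i) → q ∈ Y (inject₁ i) ⊎ x i ≡ q
    split q∈ with q ∈? Y (inject₁ i)
    ... | yes q∈′ = inj₁ q∈′
    ... | no  q∉  = inj₂ (sym (x∈⁅y⁆⇒x≡y (x i)
                      (subst (q ∈_) (proj₂ (added i)) (x∈p∧x∉q⇒x∈p─q q∈ q∉))))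

  -- By induction on the index: both sides are empty at `zero` and gain exactly `x i` at `suc i`.
  ∈Y⇔prefix : ∀ i {q} → q ∈ Y i ⇔ Prefix x i q
  ∈Y⇔prefix = <-weakInduction (λ i → ∀ {q} → q ∈ Y i ⇔ Prefix x i q)
    (mk⇔ (λ q∈ → contradiction (subst (_ ∈_) start q∈) ∉⊥) λ ())
    λ i ih → mk⇔
      (from (prefix-suc x) ∘ [ inj₁ ∘ to (prefix-inject₁ x) ∘ to ih , inj₂ ]′ ∘ to (∈Y-suc i))
      (from (∈Y-suc i) ∘ [ inj₁ ∘ from ih ∘ from (prefix-inject₁ x) , inj₂ ]′ ∘ to (prefix-suc x))

  ordering : Ordering K
  ordering = record
    { k         = k
    ; x         = x
    -- `x i` lies outside `Y (inject₁ i)`, the set of earlier values.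
    ; injective = fresh⇒injective x λ i →
        x∈p─q⇒x∉q _ _ (x∈difference i) ∘ from (∈Y⇔prefix (inject₁ i)) ∘ from (prefix-inject₁ x)
    ; image     = λ q → mk⇔
        (to (prefix-fromℕ x) ∘ to (∈Y⇔prefix (fromℕ k)) ∘ subst (q ∈_) (sym end))
        (subst (q ∈_) end ∘ from (∈Y⇔prefix (fromℕ k)) ∘ from (prefix-fromℕ x))
    }

module OrderingToChain {K : Subset n} (o : Ordering K) where
  open Ordering o

  Y : Fin m → Subset n
  Y i = comprehension (prefix? x i)

  ∈Y⇔prefix : ∀ {i : Fin m} {q} → q ∈ Y i ⇔ Prefix x i q
  ∈Y⇔prefix {i = i} = ∈-comprehension (prefix? x i)

  Y-start : Y {suc k} zero ≡ ⊥
  Y-start = Empty-unique λ (_ , q∈) → ℕ.n≮0 (proj₁ (proj₂ (to (∈Y⇔prefix {i = zero {k}}) q∈)))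

  Y-end : Y (fromℕ k) ≡ K
  Y-end = ⊆-antisym
    (λ q∈ → from (image _) (to (prefix-fromℕ x) (to ∈Y⇔prefix q∈)))
    (λ q∈ → from ∈Y⇔prefix (from (prefix-fromℕ x) (to (image _) q∈)))

  ∈Y-inject₁ : ∀ {i : Fin m} {q} → q ∈ Y (inject₁ i) ⇔ Prefix x i q
  ∈Y-inject₁ = mk⇔ (to (prefix-inject₁ x) ∘ to ∈Y⇔prefix) (from ∈Y⇔prefix ∘ from (prefix-inject₁ x))

  ∈Y-suc : ∀ {i q} → q ∈ Y (suc i) ⇔ (Prefix x i q ⊎ x i ≡ q)
  ∈Y-suc = mk⇔ (to (prefix-suc x) ∘ to ∈Y⇔prefix) (from ∈Y⇔prefix ∘ from (prefix-suc x))

  -- The step adds `x i`, and injectivity of the ordering makes this element new.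
  difference : ∀ i → Y (suc i) ─ Y (inject₁ i) ≡ ⁅ x i ⁆
  difference i = ⊆-antisym sub sup
    where
    sub : ∀ {q} → q ∈ Y (suc i) ─ Y (inject₁ i) → q ∈ ⁅ x i ⁆
    sub q∈ with to ∈Y-suc (p─q⊆p _ _ q∈)
    ... | inj₁ before = contradiction (from ∈Y-inject₁ before) (x∈p─q⇒x∉q _ _ q∈)
    ... | inj₂ refl   = x∈⁅x⁆ (x i)

    sup : ∀ {q} → q ∈ ⁅ x i ⁆ → q ∈ Y (suc i) ─ Y (inject₁ i)
    sup q∈ with refl ← x∈⁅y⁆⇒x≡y (x i) q∈ = x∈p∧x∉q⇒x∈p─q
      (from ∈Y-suc (inj₂ refl)) (injective⇒fresh x injective i ∘ to ∈Y-inject₁)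

  -- The prefixes of any ordering grow one element at a time; the family `F` enters only through
  -- `member`.
  chain : {F : Pred (Subset n) ℓ} → (∀ i → F (Y {suc k} i)) → Chain F K
  chain member = record
    { k      = k
    ; Y      = Y
    ; member = member
    ; start  = Y-start
    ; end    = Y-end
    ; mono   = λ i → from ∈Y-suc ∘ inj₁ ∘ to ∈Y-inject₁
    ; step   = λ i → trans (cong ∣_∣ (difference i)) (∣⁅x⁆∣≡1 (x i))
    }

module _ {R : Pred (Rule n) ℓ} where

  𝒜⊆ℒ : R ⊆ Nontrivial → 𝒜 R ⊆ ℒ (𝒞 R)
  𝒜⊆ℒ nontrivial (_ , chain) = ordering , before
    where
    open Chain chain using (Y; member)
    open ChainToOrdering chain

    before : ∀ i c → 𝒞 R c → root c ≡ x i → (_∈ carrier c) ≬ Prefix x i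
    before i _ (ρ , ρ∈R , refl) head≡xᵢ
      -- `Y (suc i)` is the first set of the chain that contains `x i`, the head of the rule.
      with member (suc i) ρ ρ∈R (from (∈Y-suc i) (inj₂ (sym head≡xᵢ)))
    ... | q , q∈∩ with x∈p∩q⁻ _ _ q∈∩
    ... | q∈Y , q∈body with to (prefix-suc x) (to (∈Y⇔prefix (suc i)) q∈Y)
    ... | inj₁ earlier = q , p⊆p∪q _ q∈body , earlier
    -- Here `q` would be the head itself, which nontriviality keeps out of the body.
    ... | inj₂ xᵢ≡q    = contradiction
                           (subst (_∈ body ρ) (sym (trans head≡xᵢ xᵢ≡q)) q∈body)
                           (nontrivial ρ∈R)

  ℒ⊆𝒜 : ℒ (𝒞 R) ⊆ 𝒜 R
  -- `K` is the last set of the chain, so it is accepted along with the others.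
  ℒ⊆𝒜 (o , before) = subst (𝒦 R) Y-end (accepted (fromℕ k)) , chain accepted
    where
    open Ordering o
    open OrderingToChain o

    accepted : ∀ i → 𝒦 R (Y {suc k} i)
    accepted i ρ ρ∈R head∈Y with to ∈Y⇔prefix head∈Y
    -- `j` is the position of the head in the ordering; the condition there yields `q` before it.
    ... | j , j<i , xⱼ≡head with before j (rooted ρ) (ρ , ρ∈R , refl) (sym xⱼ≡head)
    ... | q , q∈carrier , earlier@(l , l<j , xₗ≡q) with x∈p∪q⁻ _ _ q∈carrier
    ... | inj₁ q∈body = q , x∈p∩q⁺ (from ∈Y⇔prefix (l , ℕ.<-trans l<j j<i , xₗ≡q) , q∈body)
    -- If `q` were the head `x j`, that value would also occur before `j`, against injectivity.
    ... | inj₂ q∈head = contradiction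
                          (subst (Prefix x j) (trans (x∈⁅y⁆⇒x≡y _ q∈head) (sym xⱼ≡head)) earlier)
                          (injective⇒fresh x injective j)

theorem2p4 : ∀ {ℓ : Level} (n : ℕ) (R : Pred (Rule n) ℓ) →
    R ⊆ Nontrivial → 𝒜 R ≐ ℒ (𝒞 R)
theorem2p4 n R nontrivial = 𝒜⊆ℒ nontrivial , ℒ⊆𝒜
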